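{- The toroidal core graph $M$ has the Walsh index series $$W_M(\mathbf a;\mathbf b;\mathbf c)=\tfrac{1}{144}\big[a_1^8b_1^{19}+a_1^6a_2b_1^6b_2^6c_1+6(a_1^6a_2b_1^{12}b_2^3c_1+a_1^4a_2^2b_1^3b_2^7c_1^2)+9(a_1^4a_2^2b_1^5b_2^6c_1^2+a_1^2a_2^3b_2^8c_1^3)$$ $$+6(a_1^2a_2^3b_1b_2^9+a_2^4b_2^9c_1)+4(a_1^5a_3b_1^{10}b_3^3+a_1^3a_2a_3b_1^3b_2^3b_3b_6c_1)+12(a_1^3a_2a_3b_1^3b_2^3b_3^3c_1+a_1a_2^2a_3b_2^4b_3b_6c_1^2)$$ $$+4(a_1^2a_3^2b_1b_3^6+a_2a_3^2b_3^2b_6^2c_1)+18(a_1^2a_2a_4b_1b_2^2b_4^3c_2+a_2^2a_4b_2^2b_4^3c_1c_2)+12(a_1^2a_6b_1b_6^3+a_2a_6b_6^3c_1)\big],$$ and the toroidal core graph $M^*$ has the Walsh index series $$W_{M^*}(\mathbf a;\mathbf b;\mathbf c)=\tfrac{1}{144}\big[a_1^8b_1^{18}+a_1^6a_2b_1^6b_2^6+6(a_1^6a_2b_1^{11}b_2^3c_1+a_1^4a_2^2b_1^3b_2^7c_1)+9(a_1^4a_2^2b_1^4b_2^6c_1^2+a_1^2a_2^3b_2^8c_1^2)$$ $$+6(a_1^2a_2^3b_2^9+a_2^4b_2^9)+4(a_1^5a_3b_1^9b_3^3+a_1^3a_2a_3b_1^3b_2^3b_3b_6)+12(a_1^3a_2a_3b_1^2b_2^3b_3^3c_1+a_1a_2^2a_3b_2^4b_3b_6c_1)$$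 $$+4(a_1^2a_3^2b_3^6+a_2a_3^2b_3^2b_6^2)+18(a_1^2a_2a_4b_2^2b_4^3c_2+a_2^2a_4b_2^2b_4^3c_2)+12(a_1^2a_6b_6^3+a_2a_6b_6^3)\big].$$
   Context: $M$ is the graph obtained from two disjoint copies of $K_5$ by identifying an edge of one with an edge of the other (so $M$ has 8 vertices and 19 edges); $M^*$ is obtained from $M$ by deleting the edge of identification. For a finite simple graph $G$ and $\sigma\in\mathrm{Aut}(G)$, $\sigma$ induces a permutation of $E(G)$; a cycle of length $l$ of this permutation is cylindrical if $\sigma^l$ fixes both endpoints of each edge of the cycle, and Möbius if $\sigma^l$ exchanges the two endpoints of each edge of the cycle. Let $\sigma_k$ be the number of vertex cycles of $\sigma$ of length $k$, and $\mathrm{cyl}_k(G,\sigma)$, $\mathrm{m\ddot ob}_k(G,\sigma)$ the numbers of cylindrical and Möbius edge cycles of length $k$. Put $w(G,\sigma)=\prod_{k\ge1}a_k^{\sigma_k}b_k^{\mathrm{cyl}_k(G,\sigma)}c_k^{\mathrm{m\ddot ob}_k(G,\sigma)}$. The Walsh index series of (the isomorphism class of) a single graph $G$ is $$W_G(\mathbf a;\mathbf b;\mathbf c)=\frac{1}{|\mathrm{Aut}(G)|}\sum_{\sigma\in\mathrm{Aut}(G)}w(G,\sigma).$$ -}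

module Defs where

open import Level using (0ℓ)
open import Data.Bool.Base using (if_then_else_)
open import Data.Fin.Base using (Fin; zero; suc; _↑ˡ_; _↑ʳ_; punchIn)
import Data.Fin.Properties as Fin
open import Data.Fin.Permutation as Perm
  using (Permutation′; _⟨$⟩ʳ_; insert; remove; insert-remove)
open import Data.Integer.Base using (+_)
open import Data.List.Base as List
  using (List; []; _∷_; _++_; [_]; length; map; filter; foldr; upTo; allFin; deduplicate;
         cartesianProduct; cartesianProductWith)
open import Data.List.Membership.Propositional.Properties using (∈-allFin; ∈-∃++)
import Data.List.Membership.Setoid as Membership
import Data.List.Membership.Setoid.Properties as Membershipₚ
open import Data.List.Relation.Binary.Permutation.Propositional
  using (_↭_; ↭-refl; ↭-sym; ↭-trans; prep)
open import Data.List.Relation.Binary.Permutation.Propositional.Properties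
  using (∈-resp-↭; ¬x∷xs↭[]; drop-∷; shift)
open import Data.List.Relation.Unary.All using (All; []; _∷_; all?)
open import Data.List.Relation.Unary.AllPairs using ([]; _∷_)
open import Data.List.Relation.Unary.Any using (Any; here; there; any?)
import Data.List.Relation.Unary.Unique.Setoid as Unique
import Data.List.Relation.Unary.Unique.Setoid.Properties as Uniqueₚ
open import Data.List.Relation.Unary.Unique.Propositional.Properties using (allFin⁺)
open import Data.Nat.Base as ℕ using (ℕ; zero; suc; NonZero; _⊔_)
open import Data.Nat.GeneralisedArithmetic using (iterate)
import Data.Nat.Properties as ℕ
open import Data.Product.Base using (∃; ∃₂; _×_; _,_; proj₁; proj₂; uncurry)
open import Data.Product.Properties using (≡-dec)
open import Data.Rational.Base as ℚ using (ℚ; 0ℚ; 1ℚ; _/_)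
open import Data.Sum.Base as Sum using (_⊎_; [_,_]′)
open import Function.Base using (_∘_)
open import Function.Bundles using (_⇔_; mk⇔; Equivalence)
open import Function.Definitions using (Injective)
open import Relation.Binary.Bundles using (Setoid)
open import Relation.Binary.Core using (Rel)
open import Relation.Binary.Definitions using (Decidable; DecidableEquality; Symmetric)
open import Relation.Binary.PropositionalEquality as ≡ using (_≡_; _≢_; refl; cong)
open import Relation.Nullary using (¬_; Dec; yes; no; does; ¬?; _×-dec_; _⊎-dec_; _→-dec_)
open import Relation.Nullary.Decidable using (map′)

private
  variable
    n : ℕ

-- The indeterminates a_k, b_k, c_k; index 0 is never used.
data Var : Set where
  a# b# c# : ℕ → Var

_≟ᵛ_ : DecidableEquality Var
a# i ≟ᵛ a# j = map′ (cong a#) (λ { refl → refl }) (i ℕ.≟ j)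
a# _ ≟ᵛ b# _ = no λ ()
a# _ ≟ᵛ c# _ = no λ ()
b# _ ≟ᵛ a# _ = no λ ()
b# i ≟ᵛ b# j = map′ (cong b#) (λ { refl → refl }) (i ℕ.≟ j)
b# _ ≟ᵛ c# _ = no λ ()
c# _ ≟ᵛ a# _ = no λ ()
c# _ ≟ᵛ b# _ = no λ ()
c# i ≟ᵛ c# j = map′ (cong c#) (λ { refl → refl }) (i ℕ.≟ j)

-- A monomial is a product of indeterminates; two of them are the same
-- monomial when they are permutations of each other.
Monomial : Set
Monomial = List Var

infix 4 _↭?_

_↭?_ : Decidable (_↭_ {A = Var})
[]       ↭? []       = yes ↭-refl
[]       ↭? (y ∷ ys) = no (¬x∷xs↭[] ∘ ↭-sym)
(x ∷ xs) ↭? ys with any? (x ≟ᵛ_) ys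
... | no  x∉ys = no λ p → x∉ys (∈-resp-↭ p (here refl))
... | yes x∈ys with ∈-∃++ x∈ys
...   | us , vs , refl =
  map′ (λ p → ↭-trans (prep x p) (↭-sym (shift x us vs)))
       (λ p → drop-∷ (↭-trans p (shift x us vs)))
       (xs ↭? us ++ vs)

-- Formal sums of terms; like terms need not be collected, so polynomials are
-- compared by _≈_ rather than _≡_.
Poly : Set
Poly = List (ℚ × Monomial)

coeff : Poly → Monomial → ℚ
coeff p m = foldr ℚ._+_ 0ℚ (map proj₁ (filter (λ t → proj₂ t ↭? m) p))

infix  4 _≈_
infixl 6 _+_
infixl 7 _*_ _·_ _•_
infixr 8 _^_

_≈_ : Rel Poly 0ℓ
p ≈ q = ∀ m → coeff p m ≡ coeff q m

0ₚ 1ₚ : Poly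
0ₚ = []
1ₚ = [ 1ℚ , [] ]

var : Var → Poly
var x = [ 1ℚ , [ x ] ]

_+_ _*_ : Poly → Poly → Poly
_+_ = _++_
_*_ = cartesianProductWith λ { (q , m) (r , m′) → q ℚ.* r , m ++ m′ }

_·_ : ℚ → Poly → Poly
q · p = map (λ { (r , m) → q ℚ.* r , m }) p

_•_ : ℕ → Poly → Poly
k • p = (+ k / 1) · p

_^_ : Poly → ℕ → Poly
p ^ zero  = 1ₚ
p ^ suc k = p * p ^ k

∑ ∏ : List Poly → Poly
∑ = foldr _+_ 0ₚ
∏ = foldr _*_ 1ₚ

a b c : ℕ → Poly
a k = var (a# k)
b k = var (b# k)
c k = var (c# k)

-- The cycles of f, a permutation of a finite set which xs lists without
-- repetition.
module Cycles {A : Set} (_≟_ : DecidableEquality A) (f : A → A) (xs : List A) where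

  CycleLength : ℕ → A → Set
  CycleLength k x =
    1 ℕ.≤ k × iterate f x k ≡ x × (∀ {j} → j ℕ.< k → 1 ℕ.≤ j → iterate f x j ≢ x)

  cycleLength? : ∀ k x → Dec (CycleLength k x)
  cycleLength? k x =
    1 ℕ.≤? k ×-dec iterate f x k ≟ x ×-dec
    ℕ.allUpTo? (λ j → 1 ℕ.≤? j →-dec ¬? (iterate f x j ≟ x)) k

  -- For x on a cycle of length k: y lies on that cycle.
  SameCycle : ℕ → Rel A 0ℓ
  SameCycle k x y = ∃ λ j → j ℕ.< k × iterate f x j ≡ y

  sameCycle? : ∀ k → Decidable (SameCycle k)
  sameCycle? k x y = ℕ.anyUpTo? (λ j → iterate f x j ≟ y) k

  -- One representative of each cycle of length k.
  cyclesOfLength : ℕ → List A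
  cyclesOfLength k = deduplicate (sameCycle? k) (filter (cycleLength? k) xs)

record Graph (n : ℕ) : Set₁ where
  field
    Adj    : Rel (Fin n) 0ℓ
    adj?   : Decidable Adj
    sym    : Symmetric Adj
    irrefl : ∀ {i} → ¬ Adj i i

open Graph

-- The edge {i , j} is represented by the pair with i < j.
Edge : ℕ → Set
Edge n = Fin n × Fin n

_≟ᵉ_ : DecidableEquality (Edge n)
_≟ᵉ_ = ≡-dec Fin._≟_ Fin._≟_

edges : Graph n → List (Edge n)
edges {n} G = filter (λ { (i , j) → i Fin.<? j ×-dec adj? G i j })
                     (cartesianProduct (allFin n) (allFin n))

K : ∀ n → Graph n
K n .Adj        = _≢_
K n .adj? i j   = ¬? (i Fin.≟ j)
K n .sym i≢j    = i≢j ∘ ≡.sym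
K n .irrefl i≢i = i≢i refl

-- The union of the images of two graphs under injective maps into a common
-- vertex set: G and H glued along the vertices on which ι and κ agree.
module _ {p q n} (G : Graph p) (H : Graph q) (ι : Fin p → Fin n) (κ : Fin q → Fin n) where

  Image : ∀ {r} → Graph r → (Fin r → Fin n) → Rel (Fin n) 0ℓ
  Image F φ i j = ∃₂ λ u v → Adj F u v × φ u ≡ i × φ v ≡ j

  image? : ∀ {r} (F : Graph r) φ → Decidable (Image F φ)
  image? F φ i j = Fin.any? λ u → Fin.any? λ v →
    adj? F u v ×-dec φ u Fin.≟ i ×-dec φ v Fin.≟ j

  image-sym : ∀ {r} (F : Graph r) φ → Symmetric (Image F φ)
  image-sym F φ (u , v , uv , eu , ev) = v , u , sym F uv , ev , eu

  image-irrefl : ∀ {r} (F : Graph r) φ → Injective _≡_ _≡_ φ → ∀ {i} → ¬ Image F φ i i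
  image-irrefl F φ inj (u , v , uv , refl , ev) with inj ev
  ... | refl = irrefl F uv

  glue : Injective _≡_ _≡_ ι → Injective _≡_ _≡_ κ → Graph n
  glue ι-inj κ-inj .Adj i j    = Image G ι i j ⊎ Image H κ i j
  glue ι-inj κ-inj .adj? i j   = image? G ι i j ⊎-dec image? H κ i j
  glue ι-inj κ-inj .sym        = Sum.map (image-sym G ι) (image-sym H κ)
  glue ι-inj κ-inj .irrefl     = [ image-irrefl G ι ι-inj , image-irrefl H κ κ-inj ]′

deleteEdge : Graph n → Fin n → Fin n → Graph n
deleteEdge G u v .Adj i j        = Adj G i j × ¬ (i ≡ u × j ≡ v ⊎ i ≡ v × j ≡ u)
deleteEdge G u v .adj? i j       =
  adj? G i j ×-dec ¬? ((i Fin.≟ u ×-dec j Fin.≟ v) ⊎-dec (i Fin.≟ v ×-dec j Fin.≟ u))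
deleteEdge G u v .sym (ij , ≢uv) =
  sym G ij , ≢uv ∘ [ (λ (p , q) → Sum.inj₂ (q , p)) , (λ (p , q) → Sum.inj₁ (q , p)) ]′
deleteEdge G u v .irrefl         = irrefl G ∘ proj₁

-- Lists every permutation exactly once up to pointwise equality:
-- allPermutations-complete and allPermutations-unique below.
allPermutations : ∀ n → List (Permutation′ n)
allPermutations zero    = [ Perm.id ]
allPermutations (suc n) = cartesianProductWith (insert zero) (allFin (suc n)) (allPermutations n)

IsAutomorphism : Graph n → Permutation′ n → Set
IsAutomorphism G σ = ∀ i j → Adj G i j ⇔ Adj G (σ ⟨$⟩ʳ i) (σ ⟨$⟩ʳ j)

isAutomorphism? : (G : Graph n) (σ : Permutation′ n) → Dec (IsAutomorphism G σ)
isAutomorphism? G σ = Fin.all? λ i → Fin.all? λ j →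
  let e = adj? G i j ; e′ = adj? G (σ ⟨$⟩ʳ i) (σ ⟨$⟩ʳ j) in
  map′ (uncurry mk⇔) (λ p → Equivalence.to p , Equivalence.from p) ((e →-dec e′) ×-dec (e′ →-dec e))

automorphisms : Graph n → List (Permutation′ n)
automorphisms G = filter (isAutomorphism? G) (allPermutations _)

permSetoid : ℕ → Setoid 0ℓ 0ℓ
permSetoid n = record
  { Carrier       = Permutation′ n
  ; _≈_           = Perm._≈_
  ; isEquivalence = record
    { refl  = λ _ → refl
    ; sym   = λ p i → ≡.sym (p i)
    ; trans = λ p q i → ≡.trans (p i) (q i)
    }
  }

module _ {n : ℕ} where
  open Membership (permSetoid n) public using () renaming (_∈_ to _∈ₚ_)
  open Unique (permSetoid n) public using () renaming (Unique to Uniqueₚ)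

insert-cong : ∀ {i j : Fin (suc n)} {π ρ : Permutation′ n} → i ≡ j → π Perm.≈ ρ →
              insert zero i π Perm.≈ insert zero j ρ
insert-cong         refl π≈ρ zero    = refl
insert-cong {i = i} refl π≈ρ (suc k) = cong (punchIn i) (π≈ρ k)

insert-injective : ∀ {i j : Fin (suc n)} {π ρ : Permutation′ n} →
                   insert zero i π Perm.≈ insert zero j ρ → i ≡ j × π Perm.≈ ρ
insert-injective {i = i} e with e zero
... | refl = refl , λ k → Fin.punchIn-injective i _ _ (e (suc k))

allPermutations-complete : (π : Permutation′ n) → π ∈ₚ allPermutations n
allPermutations-complete {zero}  π = here λ ()
allPermutations-complete {suc n} π =
  Membershipₚ.∈-resp-≈ (permSetoid (suc n)) {x = insert zero (π ⟨$⟩ʳ zero) (remove zero π)} {π}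
    (insert-remove zero π)
    (Membershipₚ.∈-cartesianProductWith⁺ (≡.setoid _) (permSetoid n) (permSetoid (suc n))
      (λ {_} {_} {π} {ρ} → insert-cong {π = π} {ρ})
      (∈-allFin (π ⟨$⟩ʳ zero)) (allPermutations-complete (remove zero π)))

allPermutations-unique : ∀ n → Uniqueₚ (allPermutations n)
allPermutations-unique zero    = [] ∷ []
allPermutations-unique (suc n) =
  Uniqueₚ.cartesianProductWith⁺ (≡.setoid _) (permSetoid n) (permSetoid (suc n)) (insert zero)
    (λ {_} {_} {π} {ρ} → insert-injective {π = π} {ρ}) (allFin⁺ (suc n)) (allPermutations-unique n)

automorphisms-complete : (G : Graph n) (σ : Permutation′ n) → IsAutomorphism G σ → σ ∈ₚ automorphisms G
automorphisms-complete G σ =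
  Membershipₚ.∈-filter⁺ (permSetoid _) (isAutomorphism? G)
    (λ {π} {ρ} → resp {π} {ρ}) {v = σ} (allPermutations-complete σ)
  where
  resp : ∀ {π ρ} → π Perm.≈ ρ → IsAutomorphism G π → IsAutomorphism G ρ
  resp π≈ρ aut i j rewrite ≡.sym (π≈ρ i) | ≡.sym (π≈ρ j) = aut i j

automorphisms-unique : (G : Graph n) → Uniqueₚ (automorphisms G)
automorphisms-unique G =
  Uniqueₚ.filter⁺ (permSetoid _) (isAutomorphism? G) (allPermutations-unique _)

automorphisms-nonZero : (G : Graph n) → NonZero (length (automorphisms G))
automorphisms-nonZero G = nonEmpty (automorphisms-complete G Perm.id λ _ _ → mk⇔ (λ e → e) (λ e → e))
  where
  nonEmpty : ∀ {A : Set} {P : A → Set} {xs} → Any P xs → NonZero (length xs)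
  nonEmpty (here _)  = _
  nonEmpty (there _) = _

module _ (G : Graph n) (σ : Permutation′ n) where

  onVertices : Fin n → Fin n
  onVertices = σ ⟨$⟩ʳ_

  onEdges : Edge n → Edge n
  onEdges (i , j) = let i′ = onVertices i ; j′ = onVertices j in
    if does (i′ Fin.<? j′) then (i′ , j′) else (j′ , i′)

  module VertexCycles = Cycles Fin._≟_ onVertices (allFin n)
  module EdgeCycles   = Cycles _≟ᵉ_ onEdges (edges G)

  -- Conditions on the cycle of length l through the edge e.
  Cylindrical Möbius : ℕ → Edge n → Set
  Cylindrical l e = All (λ (i , j) → iterate onVertices i l ≡ i × iterate onVertices j l ≡ j)
                        (List.iterate onEdges e l)
  Möbius      l e = All (λ (i , j) → iterate onVertices i l ≡ j × iterate onVertices j l ≡ i)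
                        (List.iterate onEdges e l)

  cylindrical? : ∀ l e → Dec (Cylindrical l e)
  cylindrical? l e = all? (λ (i , j) →
    iterate onVertices i l Fin.≟ i ×-dec iterate onVertices j l Fin.≟ j) _

  möbius? : ∀ l e → Dec (Möbius l e)
  möbius? l e = all? (λ (i , j) →
    iterate onVertices i l Fin.≟ j ×-dec iterate onVertices j l Fin.≟ i) _

  vertexCycles cyl möb : ℕ → ℕ
  vertexCycles k = length (VertexCycles.cyclesOfLength k)
  cyl          k = length (filter (cylindrical? k) (EdgeCycles.cyclesOfLength k))
  möb          k = length (filter (möbius? k) (EdgeCycles.cyclesOfLength k))

  -- No cycle is longer than the bound, so all later factors are 1.
  w : Poly
  w = ∏ (map (λ k → a k ^ vertexCycles k * b k ^ cyl k * c k ^ möb k)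
             (map suc (upTo (n ⊔ length (edges G)))))

W : Graph n → Poly
W G = (+ 1 / length (automorphisms G)) · ∑ (map (w G) (automorphisms G))
  where instance _ = automorphisms-nonZero G

-- The two copies of K 5 share the vertices 0 and 1 of Fin 8; the first has the
-- further vertices 2, 3, 4 and the second 5, 6, 7.
copy₁ copy₂ : Fin 5 → Fin 8
copy₁ v = v ↑ˡ 3
copy₂ zero          = zero
copy₂ (suc zero)    = suc zero
copy₂ (suc (suc v)) = 5 ↑ʳ v

copy₁-injective : Injective _≡_ _≡_ copy₁
copy₁-injective = Fin.↑ˡ-injective 3 _ _

copy₂-injective : Injective _≡_ _≡_ copy₂
copy₂-injective {zero}        {zero}        _  = refl
copy₂-injective {zero}        {suc zero}    ()
copy₂-injective {zero}        {suc (suc _)} ()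
copy₂-injective {suc zero}    {zero}        ()
copy₂-injective {suc zero}    {suc zero}    _  = refl
copy₂-injective {suc zero}    {suc (suc _)} ()
copy₂-injective {suc (suc _)} {zero}        ()
copy₂-injective {suc (suc _)} {suc zero}    ()
copy₂-injective {suc (suc u)} {suc (suc v)} eq =
  cong (λ x → suc (suc x)) (Fin.↑ʳ-injective 5 u v eq)

M M* : Graph 8
M  = glue (K 5) (K 5) copy₁ copy₂ copy₁-injective copy₂-injective
M* = deleteEdge M zero (suc zero)

{-# OPTIONS --safe #-}
-- Both index series are evaluated. Each automorphism contributes a monomial with
-- coefficient 1 that depends only on its table of values, and the automorphisms
-- are those permutations for which every initial segment of the table preserves
-- adjacency, so a backtracking search finds all 144 of them. Two polynomials
-- agree as soon as their coefficients agree on the monomials of one of them,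
-- provided those include the monomials of the other.
module Submission where

open import Level using (0ℓ)
open import Defs
open import Data.Bool.Base using (Bool; true; false; if_then_else_)
import Data.Bool.Properties as Bool
open import Data.Empty using (⊥)
open import Data.Fin.Base using (Fin; zero; suc; punchIn)
import Data.Fin.Properties as Fin
open import Data.Fin.Permutation using (Permutation′; _⟨$⟩ʳ_; insert)
open import Data.Integer using (+_)
open import Data.List.Base as List
  using (List; []; _∷_; _++_; [_]; allFin; concatMap; cartesianProductWith; deduplicate; filter;
         length; map; replicate; upTo)
import Data.List.Properties as List
open import Data.List.Relation.Binary.Permutation.Propositional using (_↭_; ↭-sym; ↭-trans)
open import Data.List.Relation.Unary.All as All using (All; []; _∷_; all?)
import Data.List.Relation.Unary.All.Properties as All
open import Data.List.Relation.Unary.Any as Any using (Any; any?)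
open import Data.Nat.Base as ℕ using (ℕ; zero; suc; NonZero; _⊔_; z≤n; s≤s)
open import Data.Nat.GeneralisedArithmetic using (iterate)
import Data.Nat.Properties as ℕ
open import Data.Product using (_×_; _,_; proj₁; proj₂)
open import Data.Rational using (ℚ; 0ℚ; 1ℚ; _/_)
import Data.Rational as ℚ
import Data.Rational.Properties as ℚ
open import Data.Unit using (⊤; tt)
open import Data.Vec.Base as Vec using (Vec; []; _∷_; lookup; tabulate)
import Data.Vec.Properties as Vec
open import Function.Base using (_∘_; id)
open import Function.Bundles using (mk⇔)
open import Relation.Binary.Core using (Rel)
open import Relation.Binary.Definitions using (Decidable; DecidableEquality)
open import Relation.Binary.PropositionalEquality
  using (_≡_; _≢_; _≗_; refl; sym; trans; cong; cong₂; subst; module ≡-Reasoning)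
open import Relation.Nullary using (¬_; Dec; yes; no; does; ¬?; _×-dec_)
open import Relation.Nullary.Decidable using (does-⇔; dec-true; dec-false)
open import Relation.Unary using (_≐_)
import Relation.Unary as Unary

private
  variable
    m n : ℕ
    A B : Set

does-true : {P : Set} (P? : Dec P) → does P? ≡ true → P
does-true (yes p) _ = p

-- Counting cycles

iterate-cong : {f g : A → A} → f ≗ g → ∀ x k → iterate f x k ≡ iterate g x k
iterate-cong f≗g x zero = refl
iterate-cong {g = g} f≗g x (suc k) =
  trans (iterate-cong f≗g _ k) (cong (λ y → iterate g y k) (f≗g x))

listIterate-cong : {f g : A → A} → f ≗ g → ∀ x k → List.iterate f x k ≡ List.iterate g x k
listIterate-cong f≗g x zero = refl
listIterate-cong {g = g} f≗g x (suc k) =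
  cong (x ∷_) (trans (listIterate-cong f≗g _ k) (cong (λ y → List.iterate g y k) (f≗g x)))

deduplicate-≐ : {R S : Rel A 0ℓ} (R? : Decidable R) (S? : Decidable S) →
                (∀ x → R x ≐ S x) → deduplicate R? ≗ deduplicate S?
deduplicate-≐ R? S? R≐S [] = refl
deduplicate-≐ R? S? R≐S (x ∷ xs) = cong (x ∷_) (trans
  (cong (filter (¬? ∘ R? x)) (deduplicate-≐ R? S? R≐S xs))
  (List.filter-≐ (¬? ∘ R? x) (¬? ∘ S? x)
    ((λ ¬r s → ¬r (proj₂ (R≐S x) s)) , (λ ¬s r → ¬s (proj₁ (R≐S x) r)))
    (deduplicate S? xs)))

-- OrbitLength is CycleLength, decided by a walk that stops at the first return to
-- x, whereas cycleLength? computes every iterate afresh.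
module Orbits {A : Set} (_≟_ : DecidableEquality A) (f : A → A) where

  FirstHit : A → ℕ → A → Set
  FirstHit x zero    y = y ≡ x
  FirstHit x (suc k) y = y ≢ x × FirstHit x k (f y)

  firstHit? : ∀ x k y → Dec (FirstHit x k y)
  firstHit? x zero    y = y ≟ x
  firstHit? x (suc k) y = ¬? (y ≟ x) ×-dec firstHit? x k (f y)

  OrbitLength : ℕ → A → Set
  OrbitLength zero    x = ⊥
  OrbitLength (suc k) x = FirstHit x k (f x)

  orbitLength? : ∀ k x → Dec (OrbitLength k x)
  orbitLength? zero    x = no λ ()
  orbitLength? (suc k) x = firstHit? x k (f x)

  open Cycles _≟_ f [] using (CycleLength; sameCycle?)

  FirstHit⇒iterate : ∀ {x} k y → FirstHit x k y →
                     iterate f y k ≡ x × (∀ {j} → j ℕ.< k → iterate f y j ≢ x)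
  FirstHit⇒iterate zero    y y≡x       = y≡x , λ ()
  FirstHit⇒iterate (suc k) y (y≢x , h) with FirstHit⇒iterate k (f y) h
  ... | e , ≢x = e , λ { {zero} _ → y≢x ; {suc j} (s≤s j<k) → ≢x j<k }

  iterate⇒FirstHit : ∀ {x} k y → iterate f y k ≡ x →
                     (∀ {j} → j ℕ.< k → iterate f y j ≢ x) → FirstHit x k y
  iterate⇒FirstHit zero    y e ≢x = e
  iterate⇒FirstHit (suc k) y e ≢x =
    ≢x {0} (s≤s z≤n) , iterate⇒FirstHit k (f y) e (λ j<k → ≢x (s≤s j<k))

  -- The walk of `OrbitLength` starts at `f x`, whose `j`-th iterate is the `suc j`-th iterate of
  -- `x`; hence the shift between `k` and `suc k`. Length 0 is excluded on both sides.
  CycleLength≐OrbitLength : ∀ k → CycleLength k ≐ OrbitLength k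
  CycleLength≐OrbitLength zero    = (λ { (() , _) }) , λ ()
  CycleLength≐OrbitLength (suc k) =
    (λ { {x} (_ , e , ≢x) → iterate⇒FirstHit k (f x) e (λ j<k → ≢x (s≤s j<k) (s≤s z≤n)) }) ,
    λ {x} h → let e , ≢x = FirstHit⇒iterate k (f x) h in
      s≤s z≤n , e , λ { {suc j} (s≤s j<k) _ → ≢x j<k }

  orbitsOfLength : ℕ → List A → List A
  orbitsOfLength k xs = deduplicate (sameCycle? k) (filter (orbitLength? k) xs)

module _ (_≟_ : DecidableEquality A) {f g : A → A} (f≗g : f ≗ g) where

  private
    module F = Cycles _≟_ f []
    module G = Cycles _≟_ g []
  open Orbits _≟_ g

  CycleLength-cong : ∀ k → F.CycleLength k ≐ G.CycleLength k
  CycleLength-cong k =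
    (λ { {x} (1≤k , e , ≢x) → 1≤k , trans (sym (iter x k)) e , λ {j} j<k 1≤j e′ →
      ≢x j<k 1≤j (trans (iter x j) e′) }) ,
    (λ { {x} (1≤k , e , ≢x) → 1≤k , trans (iter x k) e , λ {j} j<k 1≤j e′ →
      ≢x j<k 1≤j (trans (sym (iter x j)) e′) })
    where iter = iterate-cong f≗g

  SameCycle-cong : ∀ k x → F.SameCycle k x ≐ G.SameCycle k x
  SameCycle-cong k x =
    (λ { (j , j<k , e) → j , j<k , trans (sym (iterate-cong f≗g x j)) e }) ,
    (λ { (j , j<k , e) → j , j<k , trans (iterate-cong f≗g x j) e })

  -- Filtering and deduplication see only the truth of the predicates, so both lists keep the same
  -- representatives in the same order. This trades a permutation for lookup in its table, and the
  -- costly length test for the walk.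
  cyclesOfLength≡orbitsOfLength : ∀ xs k → Cycles.cyclesOfLength _≟_ f xs k ≡ orbitsOfLength k xs
  cyclesOfLength≡orbitsOfLength xs k = trans
    (deduplicate-≐ _ _ (SameCycle-cong k) (filter (F.cycleLength? k) xs))
    (cong (deduplicate (G.sameCycle? k)) (trans
      (List.filter-≐ _ (G.cycleLength? k) (CycleLength-cong k) xs)
      (List.filter-≐ _ (orbitLength? k) (CycleLength≐OrbitLength k) xs)))

-- The monomial of a vertex map

mapEdge : (Fin n → Fin n) → Edge n → Edge n
mapEdge f (i , j) = if does (f i Fin.<? f j) then (f i , f j) else (f j , f i)

mapEdge-cong : {f g : Fin n → Fin n} → f ≗ g → mapEdge f ≗ mapEdge g
mapEdge-cong f≗g (i , j) rewrite f≗g i | f≗g j = refl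

-- The bracketing is that of the product in `w`, so that `∏-monomial` is an equality of lists and
-- not merely `_≈_`.
monomial : (v c m : ℕ → ℕ) → List ℕ → Monomial
monomial v c m = concatMap λ k →
  (replicate (v k) (a# k) ++ replicate (c k) (b# k)) ++ replicate (m k) (c# k)

monomial-cong : ∀ {v v′ c c′ m m′} → v ≗ v′ → c ≗ c′ → m ≗ m′ → monomial v c m ≗ monomial v′ c′ m′
monomial-cong v≗ c≗ m≗ = List.concatMap-cong λ k → cong₂ _++_
  (cong₂ _++_ (cong (λ l → replicate l _) (v≗ k)) (cong (λ l → replicate l _) (c≗ k)))
  (cong (λ l → replicate l _) (m≗ k))

-- Counterparts of `vertexCycles`, `cyl`, `möb` and `w` for a bare function and a list of edges,
-- both of which can be supplied already evaluated.
module Tally (es : List (Edge n)) (f : Fin n → Fin n) where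

  open Orbits Fin._≟_ f using () renaming (orbitsOfLength to vertexOrbits)
  open Orbits _≟ᵉ_ (mapEdge f) using () renaming (orbitsOfLength to edgeOrbits)

  Untwisted Twisted : ℕ → Edge n → Set
  Untwisted l (i , j) = iterate f i l ≡ i × iterate f j l ≡ j
  Twisted   l (i , j) = iterate f i l ≡ j × iterate f j l ≡ i

  untwisted? : ∀ l e → Dec (All (Untwisted l) (List.iterate (mapEdge f) e l))
  untwisted? l e = all? (λ (i , j) → iterate f i l Fin.≟ i ×-dec iterate f j l Fin.≟ j) _

  twisted? : ∀ l e → Dec (All (Twisted l) (List.iterate (mapEdge f) e l))
  twisted? l e = all? (λ (i , j) → iterate f i l Fin.≟ j ×-dec iterate f j l Fin.≟ i) _

  vertexTally cylTally möbTally : ℕ → ℕ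
  vertexTally k = length (vertexOrbits k (allFin n))
  cylTally    k = length (filter (untwisted? k) (edgeOrbits k es))
  möbTally    k = length (filter (twisted? k) (edgeOrbits k es))

  weight : Monomial
  weight = monomial vertexTally cylTally möbTally (map suc (upTo (n ⊔ length es)))

module _ (G : Graph n) (σ : Permutation′ n) {f : Fin n → Fin n} (σ≗f : (σ ⟨$⟩ʳ_) ≗ f) where

  open Tally (edges G) f

  vertexCycles≡vertexTally : ∀ k → vertexCycles G σ k ≡ vertexTally k
  vertexCycles≡vertexTally k =
    cong length (cyclesOfLength≡orbitsOfLength Fin._≟_ σ≗f (allFin n) k)

  private
    iter : ∀ i l → iterate (σ ⟨$⟩ʳ_) i l ≡ iterate f i l
    iter = iterate-cong σ≗f

    orbit : ∀ e l → List.iterate (onEdges G σ) e l ≡ List.iterate (mapEdge f) e l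
    orbit = listIterate-cong (mapEdge-cong σ≗f)

    edgeCycles : ∀ k → EdgeCycles.cyclesOfLength G σ k ≡ _
    edgeCycles = cyclesOfLength≡orbitsOfLength _≟ᵉ_ (mapEdge-cong σ≗f) (edges G)

  cyl≡cylTally : ∀ k → cyl G σ k ≡ cylTally k
  cyl≡cylTally k = cong length (trans
    (List.filter-≐ (cylindrical? G σ k) (untwisted? k)
      ((λ {e} p → subst (All _) (orbit e k) (All.map (λ { {i , j} (p , q) →
          trans (sym (iter i k)) p , trans (sym (iter j k)) q }) p)) ,
       (λ {e} p → subst (All _) (sym (orbit e k)) (All.map (λ { {i , j} (p , q) →
          trans (iter i k) p , trans (iter j k) q }) p)))
      (EdgeCycles.cyclesOfLength G σ k))
    (cong (filter (untwisted? k)) (edgeCycles k)))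

  möb≡möbTally : ∀ k → möb G σ k ≡ möbTally k
  möb≡möbTally k = cong length (trans
    (List.filter-≐ (möbius? G σ k) (twisted? k)
      ((λ {e} p → subst (All _) (orbit e k) (All.map (λ { {i , j} (p , q) →
          trans (sym (iter i k)) p , trans (sym (iter j k)) q }) p)) ,
       (λ {e} p → subst (All _) (sym (orbit e k)) (All.map (λ { {i , j} (p , q) →
          trans (iter i k) p , trans (iter j k) q }) p)))
      (EdgeCycles.cyclesOfLength G σ k))
    (cong (filter (twisted? k)) (edgeCycles k)))

var-^ : ∀ x k → var x ^ k ≡ [ 1ℚ , replicate k x ]
var-^ x zero    = refl
var-^ x (suc k) = cong (var x *_) (var-^ x k)

-- Every factor is a single term; multiplying such terms concatenates their monomials, and
-- `1ℚ ℚ.* 1ℚ` evaluates to `1ℚ`.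
∏-monomial : ∀ v c′ m ks →
             ∏ (map (λ k → a k ^ v k * b k ^ c′ k * c k ^ m k) ks) ≡ [ 1ℚ , monomial v c′ m ks ]
∏-monomial v c′ m []       = refl
∏-monomial v c′ m (k ∷ ks) = cong₂ _*_
  (cong₂ _*_ (cong₂ _*_ (var-^ (a# k) (v k)) (var-^ (b# k) (c′ k))) (var-^ (c# k) (m k)))
  (∏-monomial v c′ m ks)

w-weight : (G : Graph n) (σ : Permutation′ n) {f : Fin n → Fin n} → (σ ⟨$⟩ʳ_) ≗ f →
           w G σ ≡ [ 1ℚ , Tally.weight (edges G) f ]
w-weight {n} G σ σ≗f = trans (∏-monomial (vertexCycles G σ) (cyl G σ) (möb G σ) ks)
  (cong (λ x → [ 1ℚ , x ]) (monomial-cong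
    (vertexCycles≡vertexTally G σ σ≗f) (cyl≡cylTally G σ σ≗f) (möb≡möbTally G σ σ≗f) ks))
  where ks = map suc (upTo (n ⊔ length (edges G)))

-- Searching for automorphisms

image : (Fin m → Fin n) → Permutation′ m → Vec (Fin n) m
image t π = tabulate (t ∘ (π ⟨$⟩ʳ_))

-- Vertices are assigned images one at a time, in the order of allPermutations;
-- a partial assignment that does not preserve adjacency is abandoned.
module Search (adj : Fin n → Fin n → Bool) where

  Assignment : Set
  Assignment = Fin n × Fin n

  Compatible : Assignment → Assignment → Set
  Compatible (i , x) (j , y) = adj i j ≡ adj x y

  compatible? : Decidable Compatible
  compatible? (i , x) (j , y) = adj i j Bool.≟ adj x y

  Extends : List Assignment → (Fin m → Fin n) → Vec (Fin n) m → Set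
  Extends pre s []       = ⊤
  Extends pre s (x ∷ xs) =
    All (Compatible (s zero , x)) pre × Extends ((s zero , x) ∷ pre) (s ∘ suc) xs

  extends? : ∀ pre (s : Fin m → Fin n) xs → Dec (Extends pre s xs)
  extends? pre s []       = yes tt
  extends? pre s (x ∷ xs) =
    all? (compatible? (s zero , x)) pre ×-dec extends? ((s zero , x) ∷ pre) (s ∘ suc) xs

  -- `s` enumerates the vertices still to be assigned and `t` the values still free; `t ∘ punchIn i`
  -- removes the value just taken.
  search : List Assignment → (s t : Fin m → Fin n) → List (Vec (Fin n) m)
  search {zero}  pre s t = [ [] ]
  search {suc m} pre s t = concatMap (λ i →
      if does (all? (compatible? (s zero , t i)) pre)
      then map (t i ∷_) (search ((s zero , t i) ∷ pre) (s ∘ suc) (t ∘ punchIn i))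
      else [])
    (allFin (suc m))

  -- The test on `x` is the same for every tail, so its failure discards the whole block. This
  -- justifies abandoning a branch of the search.
  filter-map-∷ : ∀ pre (s : Fin (suc m) → Fin n) x vs →
    filter (extends? pre s) (map (x ∷_) vs) ≡
    (if does (all? (compatible? (s zero , x)) pre)
     then map (x ∷_) (filter (extends? ((s zero , x) ∷ pre) (s ∘ suc)) vs)
     else [])
  filter-map-∷ pre s x [] with does (all? (compatible? (s zero , x)) pre)
  ... | true  = refl
  ... | false = refl
  -- `ih` is bound before the case split so that the conditional in its type reduces along with the
  -- goal.
  filter-map-∷ pre s x (v ∷ vs)
    with ih ← filter-map-∷ pre s x vs | does (all? (compatible? (s zero , x)) pre)
  ... | false = ih
  ... | true with does (extends? ((s zero , x) ∷ pre) (s ∘ suc) v)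
  ...   | true  = cong (_ ∷_) ih
  ...   | false = ih

  -- `allPermutations (suc m)` is made of blocks, one for each image of `zero`. Filtering acts on
  -- each block separately, where `filter-map-∷` and induction on `m` apply; order and multiplicity
  -- are kept.
  filter-extends≡search : ∀ {m} pre (s t : Fin m → Fin n) →
    filter (extends? pre s) (map (image t) (allPermutations m)) ≡ search pre s t
  filter-extends≡search {zero}  pre s t = refl
  filter-extends≡search {suc m} pre s t = go (allFin (suc m))
    where
    open ≡-Reasoning
    ps = allPermutations m
    F = filter (extends? pre s)
    branch : Fin (suc m) → List (Vec (Fin n) (suc m))
    branch i = if does (all? (compatible? (s zero , t i)) pre)
               then map (t i ∷_) (search ((s zero , t i) ∷ pre) (s ∘ suc) (t ∘ punchIn i))
               else []
    F-branch : ∀ i → F (map (image t) (map (insert zero i) ps)) ≡ branch i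
    F-branch i = begin
      F (map (image t) (map (insert zero i) ps))
        -- `insert zero i π` sends `zero` to `i` and `suc k` to `punchIn i (π ⟨$⟩ʳ k)`, so its table
        -- computes to one with head `t i`.
        ≡⟨ cong F (sym (List.map-∘ ps)) ⟩
      F (map (λ π → t i ∷ image (t ∘ punchIn i) π) ps)
        ≡⟨ cong F (List.map-∘ ps) ⟩
      F (map (t i ∷_) (map (image (t ∘ punchIn i)) ps))
        ≡⟨ filter-map-∷ pre s (t i) (map (image (t ∘ punchIn i)) ps) ⟩
      _
        ≡⟨ cong (λ vs → if does (all? (compatible? (s zero , t i)) pre) then map (t i ∷_) vs else [])
                (filter-extends≡search ((s zero , t i) ∷ pre) (s ∘ suc) (t ∘ punchIn i)) ⟩
      branch i ∎
    go : ∀ is → F (map (image t) (cartesianProductWith (insert zero) is ps)) ≡ concatMap branch is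
    go []       = refl
    go (i ∷ is) = begin
      F (map (image t) (map (insert zero i) ps ++ rest))
        ≡⟨ cong F (List.map-++ (image t) (map (insert zero i) ps) rest) ⟩
      F (map (image t) (map (insert zero i) ps) ++ map (image t) rest)
        ≡⟨ List.filter-++ (extends? pre s) (map (image t) (map (insert zero i) ps)) _ ⟩
      F (map (image t) (map (insert zero i) ps)) ++ F (map (image t) rest)
        ≡⟨ cong₂ _++_ (F-branch i) (go is) ⟩
      branch i ++ concatMap branch is ∎
      where rest = cartesianProductWith (insert zero) is ps

  Extends-tabulate⁺ : ∀ {m} pre (s t : Fin m → Fin n) →
    (∀ k → All (Compatible (s k , t k)) pre) →
    (∀ k l → Compatible (s k , t k) (s l , t l)) → Extends pre s (tabulate t)
  Extends-tabulate⁺ {zero}  pre s t p q = tt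
  Extends-tabulate⁺ {suc m} pre s t p q =
    p zero , Extends-tabulate⁺ _ (s ∘ suc) (t ∘ suc) (λ k → q (suc k) zero ∷ p (suc k))
                               (λ k l → q (suc k) (suc l))

  Extends-tabulate⁻-pre : ∀ {m} pre (s t : Fin m → Fin n) → Extends pre s (tabulate t) →
    ∀ k → All (Compatible (s k , t k)) pre
  Extends-tabulate⁻-pre pre s t (p , e) zero    = p
  Extends-tabulate⁻-pre pre s t (p , e) (suc k) =
    All.tail (Extends-tabulate⁻-pre _ (s ∘ suc) (t ∘ suc) e k)

  module _ (adj-sym : ∀ i j → adj i j ≡ adj j i) (adj-irrefl : ∀ i → adj i i ≡ false) where

    -- `Extends` tests each vertex only against earlier ones; symmetry gives the opposite order and
    -- irreflexivity the diagonal.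
    Extends-tabulate⁻ : ∀ {m} pre (s t : Fin m → Fin n) → Extends pre s (tabulate t) →
      ∀ k l → Compatible (s k , t k) (s l , t l)
    Extends-tabulate⁻ pre s t (p , e) zero    zero    = trans (adj-irrefl _) (sym (adj-irrefl _))
    Extends-tabulate⁻ pre s t (p , e) zero    (suc l) =
      trans (adj-sym _ _)
        (trans (All.head (Extends-tabulate⁻-pre _ (s ∘ suc) (t ∘ suc) e l)) (adj-sym _ _))
    Extends-tabulate⁻ pre s t (p , e) (suc k) zero    =
      All.head (Extends-tabulate⁻-pre _ (s ∘ suc) (t ∘ suc) e k)
    Extends-tabulate⁻ pre s t (p , e) (suc k) (suc l) =
      Extends-tabulate⁻ _ (s ∘ suc) (t ∘ suc) e k l

-- Automorphisms from the adjacency matrix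

AdjacencyMatrix : ℕ → Set
AdjacencyMatrix n = Vec (Vec Bool n) n

entry : AdjacencyMatrix n → Fin n → Fin n → Bool
entry A i j = lookup (lookup A i) j

adjacencyMatrix : Graph n → AdjacencyMatrix n
adjacencyMatrix G = tabulate λ i → tabulate λ j → does (Graph.adj? G i j)

automorphismTables : AdjacencyMatrix n → List (Vec (Fin n) n)
automorphismTables A = Search.search (entry A) [] id id

map-filter : {P : A → Set} (P? : Unary.Decidable P) {Q : B → Set} (Q? : Unary.Decidable Q)
             (f : A → B) → P ≐ (Q ∘ f) → ∀ xs → map f (filter P? xs) ≡ filter Q? (map f xs)
map-filter P? Q? f P≐Q []       = refl
map-filter P? Q? f P≐Q (x ∷ xs)
  with ih ← map-filter P? Q? f P≐Q xs
     -- Abstracting the equation between the two Booleans rules out the mixed cases.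
     | does (P? x) | does (Q? (f x)) | does-⇔ (mk⇔ (proj₁ P≐Q {x}) (proj₂ P≐Q)) (P? x) (Q? (f x))
... | true  | true  | _ = cong (f x ∷_) ih
... | false | false | _ = ih

module _ (G : Graph n) where

  private
    adj = adjacencyMatrix G
    open Search (entry adj)

    entry≡ : ∀ i j → entry adj i j ≡ does (Graph.adj? G i j)
    entry≡ i j = trans (cong (λ row → lookup row j) (Vec.lookup∘tabulate _ i))
                       (Vec.lookup∘tabulate _ j)

    entry-sym : ∀ i j → entry adj i j ≡ entry adj j i
    entry-sym i j = trans (entry≡ i j) (trans
      (does-⇔ (mk⇔ (Graph.sym G) (Graph.sym G)) (Graph.adj? G i j) (Graph.adj? G j i))
      (sym (entry≡ j i)))

    entry-irrefl : ∀ i → entry adj i i ≡ false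
    entry-irrefl i = trans (entry≡ i i) (dec-false (Graph.adj? G i i) (Graph.irrefl G))

    does-≡⇒ : ∀ {P Q : Set} (P? : Dec P) (Q? : Dec Q) → does P? ≡ does Q? → P → Q
    does-≡⇒ P? Q? e p = does-true Q? (trans (sym e) (dec-true P? p))

    -- Preserving adjacency in both directions amounts to equality of the deciding Booleans, which
    -- is `Compatible` for all pairs of assignments.
    IsAutomorphism≐Extends : IsAutomorphism G ≐ (Extends [] id ∘ image id)
    IsAutomorphism≐Extends =
      (λ {σ} aut → Extends-tabulate⁺ [] id _ (λ _ → []) λ i j →
        trans (entry≡ i j) (trans (does-⇔ (aut i j) (Graph.adj? G i j) (Graph.adj? G _ _))
                                  (sym (entry≡ _ _)))) ,
      (λ {σ} ext i j →
        let e = trans (sym (entry≡ i j)) (trans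
                  (Extends-tabulate⁻ entry-sym entry-irrefl [] id _ ext i j) (entry≡ _ _))
        in mk⇔ (does-≡⇒ (Graph.adj? G i j) (Graph.adj? G _ _) e)
               (does-≡⇒ (Graph.adj? G _ _) (Graph.adj? G i j) (sym e)))

  -- As an equality of lists this yields both the order of the group and the sum over its elements.
  tables-automorphisms : map (image id) (automorphisms G) ≡ automorphismTables (adjacencyMatrix G)
  tables-automorphisms = trans
    (map-filter (isAutomorphism? G) (extends? [] id) (image id) IsAutomorphism≐Extends
                (allPermutations n))
    (filter-extends≡search [] id id)

-- Comparing polynomials

coeff-resp-↭ : ∀ p {m m′} → m ↭ m′ → coeff p m ≡ coeff p m′
coeff-resp-↭ p m↭m′ = cong (List.foldr ℚ._+_ 0ℚ ∘ map proj₁)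
  (List.filter-≐ _ _ ((λ e → ↭-trans e m↭m′) , (λ e → ↭-trans e (↭-sym m↭m′))) p)

monomials : Poly → List Monomial
monomials = map proj₂

coeff-∉ : ∀ p {m} → ¬ Any (m ↭_) (monomials p) → coeff p m ≡ 0ℚ
coeff-∉ p m∉p = cong (List.foldr ℚ._+_ 0ℚ ∘ map proj₁) (List.filter-none _
  (All.map (λ m≁ e → m≁ (↭-sym e)) (All.map⁻ (All.¬Any⇒All¬ (monomials p) m∉p))))

AgreeOnSupport : Rel Poly 0ℓ
AgreeOnSupport p q =
  All (λ m → coeff p m ≡ coeff q m) (monomials q) ×
  All (λ m → Any (m ↭_) (monomials q)) (monomials p)

agreeOnSupport? : Decidable AgreeOnSupport
agreeOnSupport? p q =
  all? (λ m → coeff p m ℚ.≟ coeff q m) _ ×-dec all? (λ m → any? (m ↭?_) (monomials q)) _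

-- A monomial of `q` up to permutation is covered by the comparison; any other is absent from `p` as
-- well, so both coefficients vanish.
agreeOnSupport⇒≈ : ∀ p q → AgreeOnSupport p q → p ≈ q
agreeOnSupport⇒≈ p q (agree , supp) m with any? (m ↭?_) (monomials q)
... | yes m∈q =
  let e , m↭m′ = All.lookupAny agree m∈q in
  trans (coeff-resp-↭ p m↭m′) (trans e (sym (coeff-resp-↭ q m↭m′)))
... | no  m∉q = trans (coeff-∉ p λ m∈p → let supp′ , m↭m′ = All.lookupAny supp m∈p in
                        m∉q (Any.map (↭-trans m↭m′) supp′))
                      (sym (coeff-∉ q m∉q))

-- Computing the index series

-- The matrix and the edge list are arguments rather than functions of the graph
-- so that they are evaluated only once, not once per automorphism.
indexTerms : AdjacencyMatrix n → List (Edge n) → ℚ → Poly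
indexTerms A es q = map (λ t → q ℚ.* 1ℚ , Tally.weight es (lookup t)) (automorphismTables A)

W-indexTerms : (G : Graph n) →
  let instance _ = automorphisms-nonZero G in
  W G ≡ indexTerms (adjacencyMatrix G) (edges G) (+ 1 / length (automorphisms G))
W-indexTerms G = trans (cong (q ·_) (∑-w (automorphisms G))) (trans
  (go (automorphisms G))
  (cong (map (λ t → q ℚ.* 1ℚ , Tally.weight (edges G) (lookup t))) (tables-automorphisms G)))
  where
  instance _ = automorphisms-nonZero G
  q = + 1 / length (automorphisms G)
  weight : Permutation′ _ → Monomial
  weight σ = Tally.weight (edges G) (lookup (image id σ))
  ∑-w : ∀ σs → ∑ (map (w G) σs) ≡ map (λ σ → 1ℚ , weight σ) σs
  ∑-w []       = refl
  ∑-w (σ ∷ σs) = cong₂ _++_ (w-weight G σ λ i → sym (Vec.lookup∘tabulate _ i)) (∑-w σs)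
  -- The factor `1ℚ` stays unsimplified so that scaling yields these terms by computation alone.
  go : ∀ σs → q · map (λ σ → 1ℚ , weight σ) σs ≡
              map (λ t → q ℚ.* 1ℚ , Tally.weight (edges G) (lookup t)) (map (image id) σs)
  go []       = refl
  go (σ ∷ σs) = cong (_ ∷_) (go σs)

-- The group order is supplied as `d` and compared with the search result, since
-- `length (automorphisms G)` would run through all permutations.
indexCheck? : (A : AdjacencyMatrix n) (es : List (Edge n)) (d : ℕ) .{{_ : NonZero d}} (p : Poly) →
  Dec (length (automorphismTables A) ≡ d × AgreeOnSupport (indexTerms A es (+ 1 / d)) p)
indexCheck? A es d p =
  length (automorphismTables A) ℕ.≟ d ×-dec agreeOnSupport? (indexTerms A es (+ 1 / d)) p

-- The hypothesis is an equation because the type checker would unfold True (…),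
-- and so run the computation, whenever it meets that type.
W-check : (G : Graph n) (d : ℕ) .{{_ : NonZero d}} (p : Poly) →
          does (indexCheck? (adjacencyMatrix G) (edges G) d p) ≡ true → W G ≈ p
W-check G d p check m = trans
  (cong (λ p′ → coeff p′ m) (trans (W-indexTerms G)
    -- `_/_` carries a proof that its denominator is nonzero, so the denominator is exchanged by
    -- `ℚ./-cong`.
    (cong (indexTerms (adjacencyMatrix G) (edges G)) (ℚ./-cong {+ 1} refl length≡d))))
  (agreeOnSupport⇒≈ (indexTerms (adjacencyMatrix G) (edges G) (+ 1 / d)) p (proj₂ checked) m)
  where
  instance _ = automorphisms-nonZero G
  checked = does-true (indexCheck? (adjacencyMatrix G) (edges G) d p) check
  length≡d : length (automorphisms G) ≡ d
  length≡d = trans (sym (List.length-map (image id) (automorphisms G)))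
    (trans (cong length (tables-automorphisms G)) (proj₁ checked))

proposition5 : (W M ≈ (+ 1 / 144) · (
    a 1 ^ 8 * b 1 ^ 19
    + a 1 ^ 6 * a 2 * b 1 ^ 6 * b 2 ^ 6 * c 1
    + 6 • (a 1 ^ 6 * a 2 * b 1 ^ 12 * b 2 ^ 3 * c 1 + a 1 ^ 4 * a 2 ^ 2 * b 1 ^ 3 * b 2 ^ 7 * c 1 ^ 2)
    + 9 • (a 1 ^ 4 * a 2 ^ 2 * b 1 ^ 5 * b 2 ^ 6 * c 1 ^ 2 + a 1 ^ 2 * a 2 ^ 3 * b 2 ^ 8 * c 1 ^ 3)
    + 6 • (a 1 ^ 2 * a 2 ^ 3 * b 1 * b 2 ^ 9 + a 2 ^ 4 * b 2 ^ 9 * c 1)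
    + 4 • (a 1 ^ 5 * a 3 * b 1 ^ 10 * b 3 ^ 3 + a 1 ^ 3 * a 2 * a 3 * b 1 ^ 3 * b 2 ^ 3 * b 3 * b 6 * c 1)
    + 12 • (a 1 ^ 3 * a 2 * a 3 * b 1 ^ 3 * b 2 ^ 3 * b 3 ^ 3 * c 1 + a 1 * a 2 ^ 2 * a 3 * b 2 ^ 4 * b 3 * b 6 * c 1 ^ 2)
    + 4 • (a 1 ^ 2 * a 3 ^ 2 * b 1 * b 3 ^ 6 + a 2 * a 3 ^ 2 * b 3 ^ 2 * b 6 ^ 2 * c 1)
    + 18 • (a 1 ^ 2 * a 2 * a 4 * b 1 * b 2 ^ 2 * b 4 ^ 3 * c 2 + a 2 ^ 2 * a 4 * b 2 ^ 2 * b 4 ^ 3 * c 1 * c 2)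
    + 12 • (a 1 ^ 2 * a 6 * b 1 * b 6 ^ 3 + a 2 * a 6 * b 6 ^ 3 * c 1)))
    ×
    (W M* ≈ (+ 1 / 144) · (
    a 1 ^ 8 * b 1 ^ 18
    + a 1 ^ 6 * a 2 * b 1 ^ 6 * b 2 ^ 6
    + 6 • (a 1 ^ 6 * a 2 * b 1 ^ 11 * b 2 ^ 3 * c 1 + a 1 ^ 4 * a 2 ^ 2 * b 1 ^ 3 * b 2 ^ 7 * c 1)
    + 9 • (a 1 ^ 4 * a 2 ^ 2 * b 1 ^ 4 * b 2 ^ 6 * c 1 ^ 2 + a 1 ^ 2 * a 2 ^ 3 * b 2 ^ 8 * c 1 ^ 2)
    + 6 • (a 1 ^ 2 * a 2 ^ 3 * b 2 ^ 9 + a 2 ^ 4 * b 2 ^ 9)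
    + 4 • (a 1 ^ 5 * a 3 * b 1 ^ 9 * b 3 ^ 3 + a 1 ^ 3 * a 2 * a 3 * b 1 ^ 3 * b 2 ^ 3 * b 3 * b 6)
    + 12 • (a 1 ^ 3 * a 2 * a 3 * b 1 ^ 2 * b 2 ^ 3 * b 3 ^ 3 * c 1 + a 1 * a 2 ^ 2 * a 3 * b 2 ^ 4 * b 3 * b 6 * c 1)
    + 4 • (a 1 ^ 2 * a 3 ^ 2 * b 3 ^ 6 + a 2 * a 3 ^ 2 * b 3 ^ 2 * b 6 ^ 2)
    + 18 • (a 1 ^ 2 * a 2 * a 4 * b 2 ^ 2 * b 4 ^ 3 * c 2 + a 2 ^ 2 * a 4 * b 2 ^ 2 * b 4 ^ 3 * c 2)
    + 12 • (a 1 ^ 2 * a 6 * b 6 ^ 3 + a 2 * a 6 * b 6 ^ 3)))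
-- The polynomials are repeated because unification cannot recover them from
-- the unfolded _≈_.
proposition5 =
  -- 144 = 2 · 3! · 3! · 2: swap the shared vertices, permute the other three vertices of each copy,
  -- exchange the copies. `refl` runs the check.
  W-check M 144 ((+ 1 / 144) · (
      a 1 ^ 8 * b 1 ^ 19
      + a 1 ^ 6 * a 2 * b 1 ^ 6 * b 2 ^ 6 * c 1
      + 6 • (a 1 ^ 6 * a 2 * b 1 ^ 12 * b 2 ^ 3 * c 1 + a 1 ^ 4 * a 2 ^ 2 * b 1 ^ 3 * b 2 ^ 7 * c 1 ^ 2)
      + 9 • (a 1 ^ 4 * a 2 ^ 2 * b 1 ^ 5 * b 2 ^ 6 * c 1 ^ 2 + a 1 ^ 2 * a 2 ^ 3 * b 2 ^ 8 * c 1 ^ 3)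
      + 6 • (a 1 ^ 2 * a 2 ^ 3 * b 1 * b 2 ^ 9 + a 2 ^ 4 * b 2 ^ 9 * c 1)
      + 4 • (a 1 ^ 5 * a 3 * b 1 ^ 10 * b 3 ^ 3 + a 1 ^ 3 * a 2 * a 3 * b 1 ^ 3 * b 2 ^ 3 * b 3 * b 6 * c 1)
      + 12 • (a 1 ^ 3 * a 2 * a 3 * b 1 ^ 3 * b 2 ^ 3 * b 3 ^ 3 * c 1 + a 1 * a 2 ^ 2 * a 3 * b 2 ^ 4 * b 3 * b 6 * c 1 ^ 2)
      + 4 • (a 1 ^ 2 * a 3 ^ 2 * b 1 * b 3 ^ 6 + a 2 * a 3 ^ 2 * b 3 ^ 2 * b 6 ^ 2 * c 1)
      + 18 • (a 1 ^ 2 * a 2 * a 4 * b 1 * b 2 ^ 2 * b 4 ^ 3 * c 2 + a 2 ^ 2 * a 4 * b 2 ^ 2 * b 4 ^ 3 * c 1 * c 2)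
      + 12 • (a 1 ^ 2 * a 6 * b 1 * b 6 ^ 3 + a 2 * a 6 * b 6 ^ 3 * c 1))) refl ,
  -- Vertices 0 and 1 remain the only ones of degree 6, so the group is the same as for `M`.
  W-check M* 144 ((+ 1 / 144) · (
      a 1 ^ 8 * b 1 ^ 18
      + a 1 ^ 6 * a 2 * b 1 ^ 6 * b 2 ^ 6
      + 6 • (a 1 ^ 6 * a 2 * b 1 ^ 11 * b 2 ^ 3 * c 1 + a 1 ^ 4 * a 2 ^ 2 * b 1 ^ 3 * b 2 ^ 7 * c 1)
      + 9 • (a 1 ^ 4 * a 2 ^ 2 * b 1 ^ 4 * b 2 ^ 6 * c 1 ^ 2 + a 1 ^ 2 * a 2 ^ 3 * b 2 ^ 8 * c 1 ^ 2)
      + 6 • (a 1 ^ 2 * a 2 ^ 3 * b 2 ^ 9 + a 2 ^ 4 * b 2 ^ 9)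
      + 4 • (a 1 ^ 5 * a 3 * b 1 ^ 9 * b 3 ^ 3 + a 1 ^ 3 * a 2 * a 3 * b 1 ^ 3 * b 2 ^ 3 * b 3 * b 6)
      + 12 • (a 1 ^ 3 * a 2 * a 3 * b 1 ^ 2 * b 2 ^ 3 * b 3 ^ 3 * c 1 + a 1 * a 2 ^ 2 * a 3 * b 2 ^ 4 * b 3 * b 6 * c 1)
      + 4 • (a 1 ^ 2 * a 3 ^ 2 * b 3 ^ 6 + a 2 * a 3 ^ 2 * b 3 ^ 2 * b 6 ^ 2)
      + 18 • (a 1 ^ 2 * a 2 * a 4 * b 2 ^ 2 * b 4 ^ 3 * c 2 + a 2 ^ 2 * a 4 * b 2 ^ 2 * b 4 ^ 3 * c 2)
      + 12 • (a 1 ^ 2 * a 6 * b 6 ^ 3 + a 2 * a 6 * b 6 ^ 3))) refl
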